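{- $\langle\forall\exists\forall\rangle\not\le_{\sf m}\langle\exists^\infty\forall^\infty\forall\rangle$.
   Context: Quantifiers range over $\omega$. $\exists^\infty n\,\varphi(n)$ means $\forall m\exists n\ge m\,\varphi(n)$ and $\forall^\infty n\,\varphi(n)$ means $\exists m\forall n\ge m\,\varphi(n)$. A quantifier-pattern is a finite string $\bar{\mathsf Q}=\mathsf Q_0\dots\mathsf Q_\ell$ over $\{\exists,\forall,\exists^\infty,\forall^\infty\}$. A $\bar{\mathsf Q}$-formula is $\varphi(\bar x)\equiv\mathsf Q_0n_0\dots\mathsf Q_\ell n_\ell\,\theta(n_0,\dots,n_\ell,\bar x)$ with $\theta$ bounded. The instance $\bar x$ is a tuple of natural numbers and/or total computable functions (computable elements of $\omega^\omega$). Spaces such as $\omega\times\omega^\omega$, $(\omega^\omega)^\omega$, $\omega^{\omega\times\omega}$ are identified with $\omega^\omega$ by computable pairing. Witnesses: for $\alpha\in\omega^\omega$, $\alpha\Vdash\varphi(\bar x)$ ("$\alpha$ is a witness for $\varphi(\bar x)$") is defined by: $\alpha\Vdash\theta(\bar x)$ iff $\alpha=\bar x$ and $\theta(\bar x)$, for bounded $\theta$; $\langle t,\alpha\rangle\Vdash\exists n\varphi(n,\bar x)$ iff $\alpha\Vdash\varphi(t,\bar x)$; $\alpha\Vdash\forall n\varphi(n,\bar x)$ iff $\alpha(n)\Vdash\varphi(n,\bar x)$ for all $n$; $\langle t,\alpha\rangle\Vdash\forall^\infty n\varphi(n,\bar x)$ iff $\alpha(n)\Vdash\varphi(n,\bar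 x)$ for all $n\ge t$; $\alpha\Vdash\exists^\infty n\varphi(n,\bar x)$ iff for all $n$, writing $\alpha(n)=\langle k,\beta\rangle$, $k\ge n$ and $\beta\Vdash\varphi(k,\bar x)$. $\varphi\le_{\sf m}\psi$ if there are computable functions $\eta,r_-,r_+$ (type-two computable functionals, possibly partial but defined wherever required) such that for every instance $\bar x$: $\varphi(\bar x)$ is true iff $\psi(\eta(\bar x))$ is true; $\alpha\Vdash\varphi(\bar x)$ implies $r_-(\alpha,\bar x)\Vdash\psi(\eta(\bar x))$; $\alpha\Vdash\psi(\eta(\bar x))$ implies $r_+(\alpha,\bar x)\Vdash\varphi(\bar x)$ ($\alpha\in\omega^\omega$ arbitrary). $\langle\bar{\mathsf Q}\rangle$ denotes a fixed $\bar{\mathsf Q}$-formula to which every $\bar{\mathsf Q}$-formula is $\le_{\sf m}$-reducible; concretely $\langle\bar{\mathsf Q}\rangle(x)\equiv\mathsf Q_0n_0\dots\mathsf Q_\ell n_\ell.\ x(n_0,\dots,n_\ell)=0$ (the choice does not matter up to $\equiv_{\sf m}$). -}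

module Defs where

open import Data.Fin using (Fin; opposite)
open import Data.List using (List; []; _∷_)
open import Data.List.NonEmpty using (List⁺; _∷_; toList)
open import Data.Nat using (ℕ; zero; suc; _+_; _*_; _<_; _≤_)
open import Data.Product using (Σ; Σ-syntax; ∃-syntax; _×_; _,_; proj₁; proj₂)
open import Data.Sum using (_⊎_)
open import Data.Vec using (Vec; []; _∷_; lookup; tabulate)
open import Function using (_∘_)
open import Function.Bundles using (_⇔_)
open import Relation.Binary.PropositionalEquality using (_≡_; _≗_)
open import Relation.Nullary using (¬_)

------------------------------------------------------------------------
-- Coding in ω^ω

ω^ω : Set
ω^ω = ℕ → ℕ

triangular : ℕ → ℕ
triangular zero    = zero
triangular (suc n) = suc n + triangular n

-- Cantor's bijection ω × ω ≅ ω, (m , n) ↦ (m + n)(m + n + 1)/2 + n.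
pair : ℕ → ℕ → ℕ
pair m n = triangular (m + n) + n

-- ω × ω^ω ≅ ω^ω: the first component is the value at 0, so that every α is
-- hd α ◃ tl α.
infixr 5 _◃_

_◃_ : ℕ → ω^ω → ω^ω
(t ◃ α) zero    = t
(t ◃ α) (suc n) = α n

hd : ω^ω → ℕ
hd α = α zero

tl : ω^ω → ω^ω
tl α = α ∘ suc

-- ω^ω ≅ (ω^ω)^ω: α [ n ] is the n-th sequence coded by α.
_[_] : ω^ω → ℕ → ω^ω
(α [ n ]) m = α (pair n m)

------------------------------------------------------------------------
-- Oracle computability

-- Codes of n-ary μ-recursive functions relative to o oracles.
data Rec (o : ℕ) : ℕ → Set where
  zeroᶠ   : ∀ {n} → Rec o n
  sucᶠ    : Rec o 1
  projᶠ   : ∀ {n} → Fin n → Rec o n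
  oracleᶠ : Fin o → Rec o 1
  compᶠ   : ∀ {m n} → Rec o m → Vec (Rec o n) m → Rec o n
  precᶠ   : ∀ {n} → Rec o n → Rec o (2 + n) → Rec o (suc n)
  μᶠ      : ∀ {n} → Rec o (suc n) → Rec o n

-- Φ ⊢ f · xs ⇓ v: the computation of f on xs with oracles Φ halts with value v.
mutual
  data _⊢_·_⇓_ {o} (Φ : Vec ω^ω o) : ∀ {n} → Rec o n → Vec ℕ n → ℕ → Set where
    zero⇓   : ∀ {n} {xs : Vec ℕ n} → Φ ⊢ zeroᶠ · xs ⇓ 0
    suc⇓    : ∀ {x} → Φ ⊢ sucᶠ · (x ∷ []) ⇓ suc x
    proj⇓   : ∀ {n} {xs : Vec ℕ n} i → Φ ⊢ projᶠ i · xs ⇓ lookup xs i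
    oracle⇓ : ∀ {x} i → Φ ⊢ oracleᶠ i · (x ∷ []) ⇓ lookup Φ i x
    comp⇓   : ∀ {m n} {f : Rec o m} {gs : Vec (Rec o n) m} {xs ys v} →
              Φ ⊢ gs ·* xs ⇓ ys → Φ ⊢ f · ys ⇓ v → Φ ⊢ compᶠ f gs · xs ⇓ v
    prec⇓₀  : ∀ {n} {f : Rec o n} {g xs v} →
              Φ ⊢ f · xs ⇓ v → Φ ⊢ precᶠ f g · (0 ∷ xs) ⇓ v
    prec⇓₁  : ∀ {n} {f : Rec o n} {g xs k u v} →
              Φ ⊢ precᶠ f g · (k ∷ xs) ⇓ u → Φ ⊢ g · (k ∷ u ∷ xs) ⇓ v →
              Φ ⊢ precᶠ f g · (suc k ∷ xs) ⇓ v
    μ⇓      : ∀ {n} {f : Rec o (suc n)} {xs v} →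
              (∀ k → k < v → ∃[ w ] Φ ⊢ f · (k ∷ xs) ⇓ suc w) →
              Φ ⊢ f · (v ∷ xs) ⇓ 0 → Φ ⊢ μᶠ f · xs ⇓ v

  data _⊢_·*_⇓_ {o} (Φ : Vec ω^ω o) {n} :
       ∀ {m} → Vec (Rec o n) m → Vec ℕ n → Vec ℕ m → Set where
    []  : ∀ {xs} → Φ ⊢ [] ·* xs ⇓ []
    _∷_ : ∀ {m f xs y ys} {fs : Vec (Rec o n) m} →
          Φ ⊢ f · xs ⇓ y → Φ ⊢ fs ·* xs ⇓ ys → Φ ⊢ (f ∷ fs) ·* xs ⇓ (y ∷ ys)

-- A code f : Rec o 1 denotes a partial computable functional (ω^ω)^o ⇀ ω^ω,
-- and f ⟪ Φ ⟫↦ y says that it is defined at Φ with value y.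
_⟪_⟫↦_ : ∀ {o} → Rec o 1 → Vec ω^ω o → ω^ω → Set
f ⟪ Φ ⟫↦ y = ∀ n → Φ ⊢ f · (n ∷ []) ⇓ y n

Computable : ω^ω → Set
Computable x = Σ[ f ∈ Rec 0 1 ] f ⟪ [] ⟫↦ x

------------------------------------------------------------------------
-- Formulas

-- Terms and bounded formulas in k number variables (de Bruijn) and one function
-- parameter x.  Tuples of parameters are coded by a single x, as ω × ω^ω ≅ ω^ω.
data Term (k : ℕ) : Set where
  var       : Fin k → Term k
  zeroᵗ     : Term k
  sucᵗ      : Term k → Term k
  _+ᵗ_ _*ᵗ_ : Term k → Term k → Term k
  pairᵗ     : Term k → Term k → Term k
  x·_       : Term k → Term k

data Bounded (k : ℕ) : Set where
  _≐_ _≼_   : Term k → Term k → Bounded k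
  ¬ᵇ_       : Bounded k → Bounded k
  _∧ᵇ_ _∨ᵇ_ : Bounded k → Bounded k → Bounded k
  ∀≤ ∃≤     : Term k → Bounded (suc k) → Bounded k

⟦_⟧ᵗ : ∀ {k} → Term k → Vec ℕ k → ω^ω → ℕ
⟦ var i ⟧ᵗ     ns x = lookup ns i
⟦ zeroᵗ ⟧ᵗ     ns x = 0
⟦ sucᵗ t ⟧ᵗ    ns x = suc (⟦ t ⟧ᵗ ns x)
⟦ s +ᵗ t ⟧ᵗ    ns x = ⟦ s ⟧ᵗ ns x + ⟦ t ⟧ᵗ ns x
⟦ s *ᵗ t ⟧ᵗ    ns x = ⟦ s ⟧ᵗ ns x * ⟦ t ⟧ᵗ ns x
⟦ pairᵗ s t ⟧ᵗ ns x = pair (⟦ s ⟧ᵗ ns x) (⟦ t ⟧ᵗ ns x)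
⟦ x· t ⟧ᵗ      ns x = x (⟦ t ⟧ᵗ ns x)

⟦_⟧ᵇ : ∀ {k} → Bounded k → Vec ℕ k → ω^ω → Set
⟦ s ≐ t ⟧ᵇ   ns x = ⟦ s ⟧ᵗ ns x ≡ ⟦ t ⟧ᵗ ns x
⟦ s ≼ t ⟧ᵇ   ns x = ⟦ s ⟧ᵗ ns x ≤ ⟦ t ⟧ᵗ ns x
⟦ ¬ᵇ θ ⟧ᵇ    ns x = ¬ ⟦ θ ⟧ᵇ ns x
⟦ θ ∧ᵇ χ ⟧ᵇ  ns x = ⟦ θ ⟧ᵇ ns x × ⟦ χ ⟧ᵇ ns x
⟦ θ ∨ᵇ χ ⟧ᵇ  ns x = ⟦ θ ⟧ᵇ ns x ⊎ ⟦ χ ⟧ᵇ ns x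
⟦ ∀≤ t θ ⟧ᵇ  ns x = ∀ n → n ≤ ⟦ t ⟧ᵗ ns x → ⟦ θ ⟧ᵇ (n ∷ ns) x
⟦ ∃≤ t θ ⟧ᵇ  ns x = ∃[ n ] n ≤ ⟦ t ⟧ᵗ ns x × ⟦ θ ⟧ᵇ (n ∷ ns) x

data Quantifier : Set where
  `∃ `∀ `∃^∞ `∀^∞ : Quantifier

Pattern : Set
Pattern = List⁺ Quantifier

-- Formulas with k free number variables and quantifier prefix Q̄.
data PrefixFormula (k : ℕ) : List Quantifier → Set where
  matrix : Bounded k → PrefixFormula k []
  quant  : ∀ Q {Q̄} → PrefixFormula (suc k) Q̄ → PrefixFormula k (Q ∷ Q̄)

Formula : Pattern → Set
Formula Q̄ = PrefixFormula 0 (toList Q̄)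

-- Here and in Witnesses, the list ns has the innermost variable first.
Holds : ∀ {k Q̄} → PrefixFormula k Q̄ → Vec ℕ k → ω^ω → Set
Holds (matrix θ)     ns x = ⟦ θ ⟧ᵇ ns x
Holds (quant `∃ φ)   ns x = ∃[ n ] Holds φ (n ∷ ns) x
Holds (quant `∀ φ)   ns x = ∀ n → Holds φ (n ∷ ns) x
Holds (quant `∃^∞ φ) ns x = ∀ m → ∃[ n ] m ≤ n × Holds φ (n ∷ ns) x
Holds (quant `∀^∞ φ) ns x = ∃[ m ] (∀ n → m ≤ n → Holds φ (n ∷ ns) x)

-- The instance (n , … , x) of a subformula, as an element of ω^ω.
instanceCode : ∀ {k} → Vec ℕ k → ω^ω → ω^ω
instanceCode []       x = x
instanceCode (n ∷ ns) x = n ◃ instanceCode ns x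

Witnesses : ∀ {k Q̄} → ω^ω → PrefixFormula k Q̄ → Vec ℕ k → ω^ω → Set
Witnesses α (matrix θ)     ns x = α ≗ instanceCode ns x × ⟦ θ ⟧ᵇ ns x
Witnesses α (quant `∃ φ)   ns x = Witnesses (tl α) φ (hd α ∷ ns) x
Witnesses α (quant `∀ φ)   ns x = ∀ n → Witnesses (α [ n ]) φ (n ∷ ns) x
Witnesses α (quant `∃^∞ φ) ns x =
  ∀ n → n ≤ hd (α [ n ]) × Witnesses (tl (α [ n ])) φ (hd (α [ n ]) ∷ ns) x
Witnesses α (quant `∀^∞ φ) ns x =
  ∀ n → hd α ≤ n → Witnesses (tl α [ n ]) φ (n ∷ ns) x

True : ∀ {Q̄} → Formula Q̄ → ω^ω → Set
True φ x = Holds φ [] x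

_⊩_at_ : ∀ {Q̄} → ω^ω → Formula Q̄ → ω^ω → Set
α ⊩ φ at x = Witnesses α φ [] x

------------------------------------------------------------------------
-- The canonical formula Q₀n₀ … Q_ℓ n_ℓ. x(n₀ , … , n_ℓ) = 0

tupleᵗ : ∀ {k n} → Vec (Term k) (suc n) → Term k
tupleᵗ (t ∷ [])     = t
tupleᵗ (t ∷ u ∷ ts) = pairᵗ t (tupleᵗ (u ∷ ts))

-- opposite puts the variables in the order n₀ , … , n_ℓ.
canonicalMatrix : ∀ k → Bounded (suc k)
canonicalMatrix k = (x· tupleᵗ (tabulate (var ∘ opposite))) ≐ zeroᵗ

canonical : ∀ k Q̄ → PrefixFormula (suc k) Q̄
canonical k []      = matrix (canonicalMatrix k)
canonical k (Q ∷ Q̄) = quant Q (canonical (suc k) Q̄)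

⟨_⟩ : (Q̄ : Pattern) → Formula Q̄
⟨ Q ∷ Q̄ ⟩ = quant Q (canonical 0 Q̄)

------------------------------------------------------------------------
-- Many-one reducibility with witnesses

record _≤ₘ_ {P̄ Q̄} (φ : Formula P̄) (ψ : Formula Q̄) : Set where
  field
    η     : Rec 1 1
    r₋ r₊ : Rec 2 1

    -- The y below is η(x).  It is unique, as computations are deterministic,
    -- and it is computable because x is.  Witnesses range over all of ω^ω.
    correct : ∀ x → Computable x →
      Σ[ y ∈ ω^ω ]
        η ⟪ x ∷ [] ⟫↦ y ×
        (True φ x ⇔ True ψ y) ×
        (∀ α → α ⊩ φ at x → Σ[ β ∈ ω^ω ] r₋ ⟪ α ∷ x ∷ [] ⟫↦ β × β ⊩ ψ at y) ×
        (∀ α → α ⊩ ψ at y → Σ[ β ∈ ω^ω ] r₊ ⟪ α ∷ x ∷ [] ⟫↦ β × β ⊩ φ at x)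

{-# OPTIONS --safe #-}

-- Let x be the zero instance and kill a value v of row a by changing x at a
-- single point ⟨a , v , c⟩ with c large.  Fed with choices b of the existential
-- values, r₋ returns rows k of η(x), valid from some t on.  Validity is monotone
-- in t, so a row k obtained from two choices b , b′ with b a ≠ b′ a stays valid,
-- for the larger of the two bounds, whichever value of row a is killed.  Only
-- finitely many rows, say those below K a, can resist in this way: otherwise r₊
-- applied to a sequence of such rows chooses a value of row a, which can then be
-- killed without invalidating the part of the sequence that r₊ has read.
-- Hence rows k ≥ K a determine b a, so by the pigeonhole principle the b a can
-- be chosen one after the other in such a way that the row found by r₋ at
-- n = K 0 is ≥ K a for all a.  But r₋ has read only finitely many values b a.
module Submission where

open import Defs
open import Axiom.ExcludedMiddle using (ExcludedMiddle)
open import Data.Empty using (⊥; ⊥-elim)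
open import Data.Fin using (Fin; zero; suc; toℕ; fromℕ<)
import Data.Fin.Properties as Fin
open import Data.List using (List; []; _∷_)
open import Data.List.NonEmpty using (_∷_)
open import Data.Nat
open import Data.Nat.Properties
open import Data.Product using (Σ-syntax; ∃; ∃-syntax; _×_; _,_; proj₁; proj₂)
open import Data.Sum using (_⊎_; inj₁; inj₂)
open import Data.Vec using (Vec; []; _∷_; lookup)
open import Function using (_∘_)
open import Level using (0ℓ)
open import Relation.Binary.Definitions using (tri<; tri≈; tri>)
open import Relation.Binary.PropositionalEquality hiding ([_])
open import Relation.Nullary using (¬_; yes; no)

-- Pairing

-- The successor in Cantor's enumeration: one step along an antidiagonal, or from its end to the
-- start of the following one.
next : ℕ × ℕ → ℕ × ℕ
next (zero  , n) = suc n , zero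
next (suc m , n) = m , suc n

unpair : ℕ → ℕ × ℕ
unpair zero    = 0 , 0
unpair (suc z) = next (unpair z)

unpair-pair : ∀ m n → unpair (pair m n) ≡ (m , n)
unpair-pair m n = diagonal (m + n) n m refl
  where
  diagonal : ∀ s n m → m + n ≡ s → unpair (pair m n) ≡ (m , n)
  diagonal s (suc n) m eq
    rewrite +-suc (triangular (m + suc n)) n | +-suc m n =
    cong next (diagonal s n (suc m) eq)
  diagonal s       zero zero    eq = refl
  diagonal (suc s) zero (suc m) eq =
    trans (cong unpair shift) (cong next (diagonal s m zero (trans (sym (+-identityʳ m)) (suc-injective eq))))
    where
    shift : pair (suc m) 0 ≡ suc (pair 0 m)
    shift rewrite +-identityʳ m | +-identityʳ (m + triangular m) = cong suc (+-comm m (triangular m))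

pair-injective : ∀ m n m′ n′ → pair m n ≡ pair m′ n′ → m ≡ m′ × n ≡ n′
pair-injective m n m′ n′ eq = cong proj₁ unpaired , cong proj₂ unpaired
  where
  unpaired : (m , n) ≡ (m′ , n′)
  unpaired = trans (sym (unpair-pair m n)) (trans (cong unpair eq) (unpair-pair m′ n′))

n≤pair : ∀ m n → n ≤ pair m n
n≤pair m n = m≤n+m n (triangular (m + n))

unpair-≤ : ∀ z → proj₁ (unpair z) + proj₂ (unpair z) ≤ z
unpair-≤ zero    = z≤n
unpair-≤ (suc z) with unpair z | unpair-≤ z
... | zero  , n | n≤z = s≤s (≤-trans (≤-reflexive (+-identityʳ n)) n≤z)
... | suc m , n | le  = ≤-trans (≤-reflexive (+-suc m n)) (m≤n⇒m≤1+n le)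

triple : ℕ → ℕ → ℕ → ℕ
triple a b c = pair a (pair b c)

n≤triple : ∀ a b c → c ≤ triple a b c
n≤triple a b c = ≤-trans (n≤pair b c) (n≤pair a (pair b c))

triple-injective : ∀ a b c a′ b′ c′ → triple a b c ≡ triple a′ b′ c′ → a ≡ a′ × b ≡ b′
triple-injective a b c a′ b′ c′ eq =
  let a≡a′ , eq′ = pair-injective a (pair b c) a′ (pair b′ c′) eq
  in a≡a′ , proj₁ (pair-injective b c b′ c′ eq′)

pack : (ℕ → ω^ω) → ω^ω
pack f p = f (proj₁ (unpair p)) (proj₂ (unpair p))

pack-[] : ∀ (f : ℕ → ω^ω) n → f n ≗ pack f [ n ]
pack-[] f n m rewrite unpair-pair n m = refl

-- Agreement of sequences on initial segments

infix 4 _≈[_]_ _≈*[_]_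

record _≈[_]_ (α : ω^ω) (s : ℕ) (β : ω^ω) : Set where
  constructor agree
  field at : ∀ n → n < s → α n ≡ β n

open _≈[_]_

≈-refl : ∀ {s α} → α ≈[ s ] α
≈-refl = agree λ _ _ → refl

≈-trans : ∀ {s α β γ} → α ≈[ s ] β → β ≈[ s ] γ → α ≈[ s ] γ
≈-trans e e′ = agree λ n n<s → trans (at e n n<s) (at e′ n n<s)

≈-mono : ∀ {s s′ α β} → s ≤ s′ → α ≈[ s′ ] β → α ≈[ s ] β
≈-mono s≤s′ e = agree λ n n<s → at e n (<-≤-trans n<s s≤s′)

◃-≈ : ∀ {s m n α β} → m ≡ n → α ≈[ s ] β → m ◃ α ≈[ s ] n ◃ β
◃-≈ m≡n e = agree λ where
  zero    _   → m≡n
  (suc p) p<s → at e p (<-trans (n<1+n p) p<s)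

-- Both components of `unpair p` are at most `p`, so below `s` only the first `s` sequences are
-- consulted, each of them below `s`.
pack-≈ : ∀ {s f g} → (∀ n → n < s → f n ≈[ s ] g n) → pack f ≈[ s ] pack g
pack-≈ e = agree λ p p<s →
  at (e _ (≤-<-trans (m+n≤o⇒m≤o _ (unpair-≤ p)) p<s)) _
     (≤-<-trans (m+n≤o⇒n≤o (proj₁ (unpair p)) (unpair-≤ p)) p<s)

record _≈*[_]_ {o} (Φ : Vec ω^ω o) (s : ℕ) (Ψ : Vec ω^ω o) : Set where
  constructor agree*
  field at* : ∀ i → lookup Φ i ≈[ s ] lookup Ψ i

open _≈*[_]_

≈*-mono : ∀ {o s s′} {Φ Ψ : Vec ω^ω o} → s ≤ s′ → Φ ≈*[ s′ ] Ψ → Φ ≈*[ s ] Ψ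
≈*-mono s≤s′ e = agree* λ i → ≈-mono s≤s′ (at* e i)

≈*-unary : ∀ {s α α′} → α ≈[ s ] α′ → α ∷ [] ≈*[ s ] α′ ∷ []
≈*-unary e = agree* λ where zero → e

≈*-binary : ∀ {s α α′ β β′} → α ≈[ s ] α′ → β ≈[ s ] β′ → α ∷ β ∷ [] ≈*[ s ] α′ ∷ β′ ∷ []
≈*-binary e e′ = agree* λ where
  zero       → e
  (suc zero) → e′

uniform-bound : {P : ℕ → ℕ → Set} → (∀ {n s s′} → s ≤ s′ → P n s → P n s′) →
                ∀ N → (∀ n → n < N → ∃ (P n)) → ∃[ s ] (∀ n → n < N → P n s)
uniform-bound mono zero    h = 0 , λ _ ()
uniform-bound {P} mono (suc N) h
  with uniform-bound mono N (λ n n<N → h n (m<n⇒m<1+n n<N)) | h N ≤-refl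
... | s , hs | s′ , hs′ = s ⊔ s′ , λ n n<1+N → case n (m<1+n⇒m<n∨m≡n n<1+N)
  where
  case : ∀ n → n < N ⊎ n ≡ N → P n (s ⊔ s′)
  case n (inj₁ n<N)  = mono (m≤m⊔n s s′) (hs n n<N)
  case n (inj₂ refl) = mono (m≤n⊔m s s′) hs′

-- Oracle computations

module _ {o : ℕ} {Φ : Vec ω^ω o} where
  mutual
    deterministic : ∀ {n} {f : Rec o n} {xs v w} → Φ ⊢ f · xs ⇓ v → Φ ⊢ f · xs ⇓ w → v ≡ w
    deterministic zero⇓       zero⇓       = refl
    deterministic suc⇓        suc⇓        = refl
    deterministic (proj⇓ i)   (proj⇓ .i)  = refl
    deterministic (oracle⇓ i) (oracle⇓ .i) = refl
    deterministic (comp⇓ ds d) (comp⇓ es e) with refl ← deterministic* ds es = deterministic d e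
    deterministic (prec⇓₀ d) (prec⇓₀ e) = deterministic d e
    deterministic (prec⇓₁ d d′) (prec⇓₁ e e′) with refl ← deterministic d e = deterministic d′ e′
    deterministic {v = v} {w} (μ⇓ ds d) (μ⇓ es e) with <-cmp v w
    ... | tri≈ _ v≡w _ = v≡w
    ... | tri< v<w _ _ with () ← deterministic d (proj₂ (es v v<w))
    ... | tri> _ _ w<v with () ← deterministic (proj₂ (ds w w<v)) e

    deterministic* : ∀ {m n} {fs : Vec (Rec o n) m} {xs vs ws} →
                     Φ ⊢ fs ·* xs ⇓ vs → Φ ⊢ fs ·* xs ⇓ ws → vs ≡ ws
    deterministic* []       []       = refl
    deterministic* (d ∷ ds) (e ∷ es) = cong₂ _∷_ (deterministic d e) (deterministic* ds es)

  mutual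
    -- A halting computation makes finitely many oracle queries. For `μᶠ`, the bounds of the trials
    -- below the value are merged by `uniform-bound`.
    use : ∀ {n} {f : Rec o n} {xs v} → Φ ⊢ f · xs ⇓ v →
          ∃[ s ] (∀ Ψ → Φ ≈*[ s ] Ψ → Ψ ⊢ f · xs ⇓ v)
    use zero⇓           = 0 , λ _ _ → zero⇓
    use suc⇓            = 0 , λ _ _ → suc⇓
    use (proj⇓ i)       = 0 , λ _ _ → proj⇓ i
    use (oracle⇓ {x} i) = suc x , λ Ψ e →
      subst (Ψ ⊢ oracleᶠ i · (x ∷ []) ⇓_) (sym (at (at* e i) x ≤-refl)) (oracle⇓ i)
    use (comp⇓ ds d) with use* ds | use d
    ... | s , hs | s′ , hs′ = s ⊔ s′ , λ Ψ e →
      comp⇓ (hs Ψ (≈*-mono (m≤m⊔n s s′) e)) (hs′ Ψ (≈*-mono (m≤n⊔m s s′) e))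
    use (prec⇓₀ d) with use d
    ... | s , hs = s , λ Ψ e → prec⇓₀ (hs Ψ e)
    use (prec⇓₁ d d′) with use d | use d′
    ... | s , hs | s′ , hs′ = s ⊔ s′ , λ Ψ e →
      prec⇓₁ (hs Ψ (≈*-mono (m≤m⊔n s s′) e)) (hs′ Ψ (≈*-mono (m≤n⊔m s s′) e))
    use (μ⇓ {f = f} {xs} {v} ds d)
      with uniform-bound {λ k s → ∀ Ψ → Φ ≈*[ s ] Ψ → ∃[ w ] Ψ ⊢ f · (k ∷ xs) ⇓ suc w}
             (λ s≤s′ h Ψ e → h Ψ (≈*-mono s≤s′ e)) v
             (λ k k<v → let s , h = use (proj₂ (ds k k<v)) in s , λ Ψ e → proj₁ (ds k k<v) , h Ψ e)
         | use d
    ... | s , hs | s′ , hs′ = s ⊔ s′ , λ Ψ e →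
      μ⇓ (λ k k<v → hs k k<v Ψ (≈*-mono (m≤m⊔n s s′) e)) (hs′ Ψ (≈*-mono (m≤n⊔m s s′) e))

    use* : ∀ {m n} {fs : Vec (Rec o n) m} {xs vs} → Φ ⊢ fs ·* xs ⇓ vs →
           ∃[ s ] (∀ Ψ → Φ ≈*[ s ] Ψ → Ψ ⊢ fs ·* xs ⇓ vs)
    use* []       = 0 , λ _ _ → []
    use* (d ∷ ds) with use d | use* ds
    ... | s , hs | s′ , hs′ = s ⊔ s′ , λ Ψ e →
      hs Ψ (≈*-mono (m≤m⊔n s s′) e) ∷ hs′ Ψ (≈*-mono (m≤n⊔m s s′) e)

-- `use` transfers each of the first `N` computations to `Ψ`, where determinism identifies the
-- results with those of `z`.
functional-continuous : ∀ {o} {Φ : Vec ω^ω o} {f y} → f ⟪ Φ ⟫↦ y → ∀ N →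
  ∃[ s ] (∀ {Ψ z} → Φ ≈*[ s ] Ψ → f ⟪ Ψ ⟫↦ z → y ≈[ N ] z)
functional-continuous {Φ = Φ} {f} {y} d N =
  let s , hs = uniform-bound {λ n s → ∀ Ψ → Φ ≈*[ s ] Ψ → Ψ ⊢ f · (n ∷ []) ⇓ y n}
                 (λ s≤s′ h Ψ e → h Ψ (≈*-mono s≤s′ e)) N (λ n _ → use (d n))
  in s , λ e d′ → agree λ n n<N → deterministic (hs n n<N _ e) (d′ n)

-- Instances that vanish everywhere, or everywhere but at p

𝟘 : ω^ω
𝟘 _ = 0

𝟘-computable : Computable 𝟘
𝟘-computable = zeroᶠ , λ _ → zero⇓

-- The recursion on both arguments mirrors the primitive recursive code in `δ-computable`.
δ : ℕ → ω^ω
δ zero    zero    = 1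
δ zero    (suc n) = 0
δ (suc p) zero    = 0
δ (suc p) (suc n) = δ p n

δ-diagonal : ∀ p → δ p p ≡ 1
δ-diagonal zero    = refl
δ-diagonal (suc p) = δ-diagonal p

δ-off-diagonal : ∀ p n → n ≢ p → δ p n ≡ 0
δ-off-diagonal zero    zero    n≢p = ⊥-elim (n≢p refl)
δ-off-diagonal zero    (suc n) n≢p = refl
δ-off-diagonal (suc p) zero    n≢p = refl
δ-off-diagonal (suc p) (suc n) n≢p = δ-off-diagonal p n (n≢p ∘ cong suc)

δ-computable : ∀ p → Computable (δ p)
δ-computable p = code p , computes p
  where
  code : ℕ → Rec 0 1
  code zero    = precᶠ (compᶠ sucᶠ (zeroᶠ ∷ [])) zeroᶠ
  code (suc p) = precᶠ zeroᶠ (compᶠ (code p) (projᶠ zero ∷ []))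

  computes : ∀ p → code p ⟪ [] ⟫↦ δ p
  computes zero    zero    = prec⇓₀ (comp⇓ (zero⇓ ∷ []) suc⇓)
  computes zero    (suc n) = prec⇓₁ (computes zero n) zero⇓
  computes (suc p) zero    = prec⇓₀ zero⇓
  computes (suc p) (suc n) =
    prec⇓₁ (computes (suc p) n) (comp⇓ (proj⇓ zero ∷ []) (computes p n))

𝟘≈δ : ∀ {s p} → s ≤ p → 𝟘 ≈[ s ] δ p
𝟘≈δ {p = p} s≤p = agree λ n n<s → sym (δ-off-diagonal p n (<⇒≢ (<-≤-trans n<s s≤p)))

-- Witnesses

-- Stands in for extensionality: by `pack-[]`, a section of a packed sequence is only pointwise
-- equal to the intended one.
Witnesses-resp : ∀ {k Q̄ α β} (φ : PrefixFormula k Q̄) ns x → α ≗ β →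
                 Witnesses α φ ns x → Witnesses β φ ns x
Witnesses-resp (matrix θ) ns x e (e′ , h) = (λ n → trans (sym (e n)) (e′ n)) , h
Witnesses-resp {β = β} (quant `∃ φ) ns x e w =
  subst (λ t → Witnesses (tl β) φ (t ∷ ns) x) (e 0) (Witnesses-resp φ (_ ∷ ns) x (e ∘ suc) w)
Witnesses-resp (quant `∀ φ) ns x e w n = Witnesses-resp φ (n ∷ ns) x (λ m → e (pair n m)) (w n)
Witnesses-resp {β = β} (quant `∃^∞ φ) ns x e w n =
  subst (n ≤_) (e _) (proj₁ (w n)) ,
  subst (λ k → Witnesses (tl (β [ n ])) φ (k ∷ ns) x) (e _)
    (Witnesses-resp φ (_ ∷ ns) x (λ m → e (pair n (suc m))) (proj₂ (w n)))
Witnesses-resp (quant `∀^∞ φ) ns x e w n t≤n =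
  Witnesses-resp φ (n ∷ ns) x (λ m → e (suc (pair n m))) (w n (subst (_≤ n) (sym (e 0)) t≤n))

module _ {k : ℕ} {Q̄ : List Quantifier}
         (φ : PrefixFormula (suc k) Q̄) (ns : Vec ℕ k) (x : ω^ω) where

  pack-witnesses-∀ : ∀ (f : ℕ → ω^ω) → (∀ n → Witnesses (f n) φ (n ∷ ns) x) →
                     Witnesses (pack f) (quant `∀ φ) ns x
  pack-witnesses-∀ f w n = Witnesses-resp φ (n ∷ ns) x (pack-[] f n) (w n)

  pack-witnesses-∀^∞ : ∀ t (f : ℕ → ω^ω) → (∀ n → t ≤ n → Witnesses (f n) φ (n ∷ ns) x) →
                       Witnesses (t ◃ pack f) (quant `∀^∞ φ) ns x
  pack-witnesses-∀^∞ t f w n t≤n = Witnesses-resp φ (n ∷ ns) x (pack-[] f n) (w n t≤n)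

  pack-witnesses-∃^∞ : ∀ (m : ω^ω) (f : ℕ → ω^ω) →
    (∀ n → n ≤ m n × Witnesses (f n) φ (m n ∷ ns) x) →
    Witnesses (pack (λ n → m n ◃ f n)) (quant `∃^∞ φ) ns x
  pack-witnesses-∃^∞ m f w n =
    subst (n ≤_) (e 0) (proj₁ (w n)) ,
    subst (λ i → Witnesses (tl (pack g [ n ])) φ (i ∷ ns) x) (e 0)
      (Witnesses-resp φ (m n ∷ ns) x (e ∘ suc) (proj₂ (w n)))
    where
    g : ℕ → ω^ω
    g n = m n ◃ f n

    e : g n ≗ pack g [ n ]
    e = pack-[] g n

-- Explicit witnesses for the two formulas

∀∃∀ : Formula (`∀ ∷ `∃ ∷ `∀ ∷ [])
∀∃∀ = ⟨ `∀ ∷ `∃ ∷ `∀ ∷ [] ⟩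

∃^∞∀^∞∀ : Formula (`∃^∞ ∷ `∀^∞ ∷ `∀ ∷ [])
∃^∞∀^∞∀ = ⟨ `∃^∞ ∷ `∀^∞ ∷ `∀ ∷ [] ⟩

-- Skolem functions for the existential quantifier.
Chooses : ω^ω → ω^ω → Set
Chooses b x = ∀ a c → x (triple a (b a) c) ≡ 0

-- `t` is a threshold for the quantifier ∀^∞ in row `k`.
Valid : ω^ω → ℕ → ℕ → Set
Valid y k t = ∀ b → t ≤ b → ∀ c → y (triple k b c) ≡ 0

Valid-mono : ∀ y k {t t′} → t ≤ t′ → Valid y k t → Valid y k t′
Valid-mono y k t≤t′ h b t′≤b = h b (≤-trans t≤t′ t′≤b)

choiceCell : ω^ω → ω^ω → ℕ → ℕ → ω^ω
choiceCell b x a c = instanceCode (c ∷ b a ∷ a ∷ []) x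

-- A matrix is witnessed only by its own instance, so every cell carries a copy of `x`. Changing the
-- instance changes the witness too, but by `choiceWitness-≈` a late change shows up late.
choiceWitness : ω^ω → ω^ω → ω^ω
choiceWitness b x = pack λ a → b a ◃ pack (choiceCell b x a)

choiceWitness-⊩ : ∀ b x → Chooses b x → choiceWitness b x ⊩ ∀∃∀ at x
choiceWitness-⊩ b x h =
  pack-witnesses-∀ (canonical 0 (`∃ ∷ `∀ ∷ [])) [] x (λ a → b a ◃ pack (choiceCell b x a)) λ a →
  pack-witnesses-∀ (canonical 2 []) (b a ∷ a ∷ []) x (choiceCell b x a) λ c →
  (λ _ → refl) , h a c

choiceWitness-≈ : ∀ {s b b′ x x′} → b ≈[ s ] b′ → x ≈[ s ] x′ →
                  choiceWitness b x ≈[ s ] choiceWitness b′ x′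
choiceWitness-≈ eb ex = pack-≈ λ a a<s → ◃-≈ (at eb a a<s) (pack-≈ λ c _ →
  ◃-≈ {m = c} refl (◃-≈ (at eb a a<s) (◃-≈ {m = a} refl ex)))

rowCell : ω^ω → ω^ω → ℕ → ℕ → ℕ → ω^ω
rowCell k y n b c = instanceCode (c ∷ b ∷ k n ∷ []) y

rowWitness : ω^ω → ω^ω → ω^ω → ω^ω
rowWitness k t y = pack λ n → k n ◃ t n ◃ pack λ b → pack (rowCell k y n b)

rowWitness-⊩ : ∀ k t y → (∀ n → n ≤ k n) → (∀ n → Valid y (k n) (t n)) →
               rowWitness k t y ⊩ ∃^∞∀^∞∀ at y
rowWitness-⊩ k t y n≤k valid =
  pack-witnesses-∃^∞ (canonical 0 (`∀^∞ ∷ `∀ ∷ [])) [] y k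
    (λ n → t n ◃ pack λ b → pack (rowCell k y n b)) λ n → n≤k n ,
  pack-witnesses-∀^∞ (canonical 1 (`∀ ∷ [])) (k n ∷ []) y (t n)
    (λ b → pack (rowCell k y n b)) λ b t≤b →
  pack-witnesses-∀ (canonical 2 []) (b ∷ k n ∷ []) y (rowCell k y n b) λ c →
  (λ _ → refl) , valid n b t≤b c

rowWitness-≈ : ∀ {s k k′ t t′ y y′} → k ≈[ s ] k′ → t ≈[ s ] t′ → y ≈[ s ] y′ →
               rowWitness k t y ≈[ s ] rowWitness k′ t′ y′
rowWitness-≈ ek et ey = pack-≈ λ n n<s → ◃-≈ (at ek n n<s) (◃-≈ (at et n n<s) (pack-≈ λ b _ →
  pack-≈ λ c _ → ◃-≈ {m = c} refl (◃-≈ {m = b} refl (◃-≈ (at ek n n<s) ey))))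

row : ω^ω → ℕ → ℕ
row β n = hd (β [ n ])

bound : ω^ω → ℕ → ℕ
bound β n = hd (tl (β [ n ]))

row-valid : ∀ β y → β ⊩ ∃^∞∀^∞∀ at y → ∀ n → Valid y (row β n) (bound β n)
row-valid β y w n b t≤b c = proj₂ (proj₂ (w n) b t≤b c)

choice : ω^ω → ℕ → ℕ
choice β a = hd (β [ a ])

choice-chooses : ∀ β x → β ⊩ ∀∃∀ at x → Chooses (choice β) x
choice-chooses β x w a c = proj₂ (w a c)

_[_↦_] : ω^ω → ℕ → ℕ → ω^ω
(b [ a ↦ v ]) i with i ≟ a
... | yes _ = v
... | no  _ = b i

↦-here : ∀ b a v → (b [ a ↦ v ]) a ≡ v
↦-here b a v with a ≟ a
... | yes _   = refl
... | no  a≢a = ⊥-elim (a≢a refl)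

↦-≈ : ∀ {s b a} v → s ≤ a → b ≈[ s ] b [ a ↦ v ]
↦-≈ {s} {b} {a} v s≤a = agree unchanged
  where
  unchanged : ∀ i → i < s → b i ≡ (b [ a ↦ v ]) i
  unchanged i i<s with i ≟ a
  ... | yes refl = ⊥-elim (<⇒≱ i<s s≤a)
  ... | no  _    = refl

-- Images of the instances under an assumed reduction

module _ (em : ExcludedMiddle 0ℓ) (reduction : ∀∃∀ ≤ₘ ∃^∞∀^∞∀) where

  open _≤ₘ_ reduction

  image : ∀ {x} → Computable x → ω^ω
  image cx = proj₁ (correct _ cx)

  image-computes : ∀ {x} (cx : Computable x) → η ⟪ x ∷ [] ⟫↦ image cx
  image-computes cx = proj₁ (proj₂ (correct _ cx))

  forward : ∀ {x} (cx : Computable x) α → α ⊩ ∀∃∀ at x →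
            Σ[ β ∈ ω^ω ] r₋ ⟪ α ∷ x ∷ [] ⟫↦ β × β ⊩ ∃^∞∀^∞∀ at image cx
  forward cx = proj₁ (proj₂ (proj₂ (proj₂ (correct _ cx))))

  backward : ∀ {x} (cx : Computable x) α → α ⊩ ∃^∞∀^∞∀ at image cx →
             Σ[ β ∈ ω^ω ] r₊ ⟪ α ∷ x ∷ [] ⟫↦ β × β ⊩ ∀∃∀ at x
  backward cx = proj₂ (proj₂ (proj₂ (proj₂ (correct _ cx))))

  y₀ : ω^ω
  y₀ = image 𝟘-computable

  yδ : ℕ → ω^ω
  yδ p = image (δ-computable p)

  y₀≈yδ : ∀ N → ∃[ s ] (∀ p → s ≤ p → y₀ ≈[ N ] yδ p)
  y₀≈yδ N =
    let s , h = functional-continuous (image-computes 𝟘-computable) N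
    in s , λ p s≤p → h (≈*-unary (𝟘≈δ s≤p)) (image-computes (δ-computable p))

  -- Rows that survive the killing of a value

  -- Only large `c` count, since continuity controls a change of the instance only beyond what has
  -- been read.
  Safe : ℕ → ℕ → ℕ → ℕ → Set
  Safe a v k t = ∃[ s ] (∀ c → s ≤ c → Valid (yδ (triple a v c)) k t)

  Safe-mono : ∀ a v k {t t′} → t ≤ t′ → Safe a v k t → Safe a v k t′
  Safe-mono a v k t≤t′ (s , h) = s , λ c s≤c → Valid-mono (yδ (triple a v c)) k t≤t′ (h c s≤c)

  -- By continuity of `η`, any single value of `y₀` is also the value of `yδ p` for all large `p`.
  Safe⇒Valid : ∀ a v k t → Safe a v k t → Valid y₀ k t
  Safe⇒Valid a v k t (s , h) b t≤b c =
    let s′ , h′ = y₀≈yδ (suc (triple k b c))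
        m       = s ⊔ s′
    in trans (at (h′ (triple a v m) (≤-trans (m≤n⊔m s s′) (n≤triple a v m))) _ ≤-refl)
             (h m (m≤m⊔n s s′) b t≤b c)

  Chooses-δ : ∀ b a v c → b a ≢ v → Chooses b (δ (triple a v c))
  Chooses-δ b a v c ba≢v a′ c′ = δ-off-diagonal (triple a v c) (triple a′ (b a′) c′) λ eq →
    let a′≡a , ba′≡v = triple-injective a′ (b a′) c′ a v c eq
    in ba≢v (subst (λ i → b i ≡ v) a′≡a ba′≡v)

  -- Every `b` is a Skolem function for the zero instance, so `r₋` answers all of them with rows of
  -- the same `y₀`.
  forward₀ : ∀ b → Σ[ β ∈ ω^ω ] r₋ ⟪ choiceWitness b 𝟘 ∷ 𝟘 ∷ [] ⟫↦ β × β ⊩ ∃^∞∀^∞∀ at y₀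
  forward₀ b = forward 𝟘-computable (choiceWitness b 𝟘) (choiceWitness-⊩ b 𝟘 λ _ _ → refl)

  k t : ω^ω → ℕ → ℕ
  k b = row (proj₁ (forward₀ b))
  t b = bound (proj₁ (forward₀ b))

  n≤k : ∀ b n → n ≤ k b n
  n≤k b n = proj₁ (proj₂ (proj₂ (forward₀ b)) n)

  -- Some `b′` that `r₋` cannot tell from `b` avoids `v` at `a`, hence is a choice for the killed
  -- instance as well; there `r₋` must return the same row and bound.
  forward-safe : ∀ b n → ∃[ m ] (∀ a v → m ≤ a ⊎ b a ≢ v → Safe a v (k b n) (t b n))
  -- Row and bound number `n` are the values at `pair n 0` and `pair n 1`; the precision exceeds
  -- both.
  forward-safe b n with functional-continuous (proj₁ (proj₂ (forward₀ b))) (suc (pair n 0 + pair n 1))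
  ... | m , cont = m , λ where
      -- The choice at `a` has not been read, so it may be moved off `v`; `suc v` is just some other
      -- value.
      a v (inj₁ m≤a)  → safe a v (b [ a ↦ suc v ]) (↦-≈ (suc v) m≤a)
                          (λ eq → 1+n≢n (trans (sym (↦-here b a (suc v))) eq))
      a v (inj₂ ba≢v) → safe a v b ≈-refl ba≢v
    where
    safe : ∀ a v b′ → b ≈[ m ] b′ → b′ a ≢ v → Safe a v (k b n) (t b n)
    safe a v b′ b≈b′ b′a≢v = m , λ c m≤c →
      let p           = triple a v c
          𝟘≈          = 𝟘≈δ (≤-trans m≤c (n≤triple a v c))
          β , r , w   = forward (δ-computable p) (choiceWitness b′ (δ p))
                          (choiceWitness-⊩ b′ (δ p) (Chooses-δ b′ a v c b′a≢v))
          e           = cont (≈*-binary (choiceWitness-≈ b≈b′ 𝟘≈) 𝟘≈) r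
      in subst₂ (Valid (yδ p)) (sym (at e (pair n 0) (s≤s (m≤m+n _ _))))
           (sym (at e (pair n 1) (s≤s (m≤n+m _ (pair n 0))))) (row-valid β (yδ p) w n)

  -- The bound `t` is uniform in `v`, whereas the threshold for `c` inside `Safe` may depend on `v`.
  Robust : ℕ → ℕ → Set
  Robust a k = ∃[ t ] (∀ v → Safe a v k t)

  -- No `v` equals both `b a` and `b′ a`, so one of the two choices always avoids `v`; the maximum
  -- of the bounds serves both.
  robust-of-two : ∀ b b′ a n → k b n ≡ k b′ n → b a ≢ b′ a → Robust a (k b n)
  robust-of-two b b′ a n eq ba≢b′a = t b n ⊔ t b′ n , safe
    where
    safe : ∀ v → Safe a v (k b n) (t b n ⊔ t b′ n)
    safe v with b a ≟ v
    ... | no  ba≢v = Safe-mono a v (k b n) (m≤m⊔n _ _) (proj₂ (forward-safe b n) a v (inj₂ ba≢v))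
    ... | yes refl = subst (λ i → Safe a v i (t b n ⊔ t b′ n)) (sym eq)
      (Safe-mono a v (k b′ n) (m≤n⊔m (t b n) _) (proj₂ (forward-safe b′ n) a v (inj₂ (ba≢b′a ∘ sym))))

  -- At an index `a` beyond the use of `r₋`, every `v` can be avoided with the same answer.
  robust-of-unread : ∀ b n → ∃[ a ] Robust a (k b n)
  robust-of-unread b n =
    let m , safe = forward-safe b n
    in m , t b n , λ v → safe m v (inj₁ ≤-refl)

  -- Boundedness of robust rows

  splice : ℕ → ω^ω → ω^ω → ω^ω
  splice s α α′ n with n <? s
  ... | yes _ = α n
  ... | no  _ = α′ n

  splice-≈ : ∀ s α α′ → α ≈[ s ] splice s α α′
  splice-≈ s α α′ = agree unchanged
    where
    unchanged : ∀ n → n < s → α n ≡ splice s α α′ n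
    unchanged n n<s with n <? s
    ... | yes _   = refl
    ... | no  n≮s = ⊥-elim (n≮s n<s)

  -- The rows beyond s are supplied by r₋, as δ ⟨a , v , c⟩ is a true instance: take suc v in row a.
  complete : ∀ a v c s κ τ → (∀ n → n ≤ κ n) →
    (∀ n → n < s → Valid (yδ (triple a v c)) (κ n) (τ n)) →
    Σ[ κ′ ∈ ω^ω ] Σ[ τ′ ∈ ω^ω ] κ ≈[ s ] κ′ × τ ≈[ s ] τ′ ×
      rowWitness κ′ τ′ (yδ (triple a v c)) ⊩ ∃^∞∀^∞∀ at yδ (triple a v c)
  complete a v c s κ τ n≤κ valid =
    let b         = λ _ → suc v
        x         = δ (triple a v c)
        y         = yδ (triple a v c)
        β , _ , w = forward (δ-computable (triple a v c)) (choiceWitness b x)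
                      (choiceWitness-⊩ b x (Chooses-δ b a v c 1+n≢n))
    in splice s κ (row β) , splice s τ (bound β) , splice-≈ s κ (row β) , splice-≈ s τ (bound β) ,
       rowWitness-⊩ (splice s κ (row β)) (splice s τ (bound β)) y
         (n≤splice β (λ n → proj₁ (w n))) (valid-splice β (row-valid β y w))
    where
    n≤splice : ∀ β → (∀ n → n ≤ row β n) → ∀ n → n ≤ splice s κ (row β) n
    n≤splice β n≤row n with n <? s
    ... | yes _ = n≤κ n
    ... | no  _ = n≤row n

    valid-splice : ∀ β → (∀ n → Valid (yδ (triple a v c)) (row β n) (bound β n)) →
      ∀ n → Valid (yδ (triple a v c)) (splice s κ (row β) n) (splice s τ (bound β) n)
    valid-splice β valid′ n with n <? s
    ... | yes n<s = valid n n<s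
    ... | no  _   = valid′ n

  -- Let `r₊` pick a value `v` for row `a` of the zero instance, and kill `v` beyond everything
  -- read. The part read extends to a witness for the killed instance, from which `r₊` picks `v`
  -- again, now wrongly.
  ¬always-safe : ∀ a κ τ → (∀ n → n ≤ κ n) → ¬ (∀ n v → Safe a v (κ n) (τ n))
  ¬always-safe a κ τ n≤κ safe
    with backward 𝟘-computable (rowWitness κ τ y₀)
           (rowWitness-⊩ κ τ y₀ n≤κ (λ n → Safe⇒Valid a 0 (κ n) (τ n) (safe n 0)))
  ... | β , r , _
    with functional-continuous r (suc (pair a 0))
  ... | s , read
    -- Only the first `s` rows are read, so one threshold for `c` covers them.
    with uniform-bound {λ n c → ∀ c′ → c ≤ c′ → Valid (yδ (triple a (choice β a) c′)) (κ n) (τ n)}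
           (λ c≤c′ h c″ c′≤c″ → h c″ (≤-trans c≤c′ c′≤c″)) s (λ n _ → safe n (choice β a))
       | y₀≈yδ s
  -- `c` must keep those rows valid, and leave both the image and the instance unchanged below `s`.
  ... | c₁ , valid | c₂ , y₀≈ =
    kill (c₁ ⊔ (c₂ ⊔ s)) (m≤m⊔n c₁ (c₂ ⊔ s))
      (≤-trans (m≤m⊔n c₂ s) (m≤n⊔m c₁ (c₂ ⊔ s))) (≤-trans (m≤n⊔m c₂ s) (m≤n⊔m c₁ (c₂ ⊔ s)))
    where
    kill : ∀ c → c₁ ≤ c → c₂ ≤ c → s ≤ c → ⊥
    kill c c₁≤c c₂≤c s≤c =
      let v                       = choice β a
          p                       = triple a v c
          c≤p                     = n≤triple a v c
          κ′ , τ′ , eκ , eτ , w   = complete a v c s κ τ n≤κ (λ n n<s → valid n n<s c c₁≤c)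
          β′ , r′ , w′            = backward (δ-computable p) (rowWitness κ′ τ′ (yδ p)) w
          e                       = read (≈*-binary
                                      (rowWitness-≈ eκ eτ (y₀≈ p (≤-trans c₂≤c c≤p)))
                                      (𝟘≈δ (≤-trans s≤c c≤p))) r′
          v≡                      = at e (pair a 0) ≤-refl
      in 0≢1+n (trans (sym (subst (λ i → δ p (triple a i c) ≡ 0) (sym v≡)
                             (choice-chooses β′ (δ p) w′ a c)))
                      (δ-diagonal p))

  ¬robust-infinite : ∀ a → ¬ (∀ n → ∃[ i ] n ≤ i × Robust a i)
  ¬robust-infinite a robust =
    ¬always-safe a (λ n → proj₁ (robust n)) (λ n → proj₁ (proj₂ (proj₂ (robust n))))
      (λ n → proj₁ (proj₂ (robust n))) (λ n → proj₂ (proj₂ (proj₂ (robust n))))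

  robust-bounded : ∀ a → ∃[ K ] (∀ i → K ≤ i → ¬ Robust a i)
  robust-bounded a with em {∃[ K ] (∀ i → K ≤ i → ¬ Robust a i)}
  ... | yes bounded = bounded
  ... | no  ¬bounded = ⊥-elim (¬robust-infinite a infinite)
    where
    infinite : ∀ n → ∃[ i ] n ≤ i × Robust a i
    infinite n with em {∃[ i ] n ≤ i × Robust a i}
    ... | yes found = found
    ... | no  none  = ⊥-elim (¬bounded (n , λ i n≤i r → none (i , n≤i , r)))

  -- Choosing values that force ever larger rows

  K : ℕ → ℕ
  K a = proj₁ (robust-bounded a)

  -- A condition on the first `m` values of `b` alone; quantifying over all their continuations lets
  -- it pass to the limit.
  Large : ℕ → ω^ω → Set
  Large m b = ∀ b′ → b ≈[ m ] b′ → K m ≤ k b′ (K 0)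

  -- If every value at `m` failed, two distinct values would yield the same row below `K (suc m)`.
  -- By `robust-of-two` it is robust for `m`, although `Large m b` puts it at `K m` or above.
  large-extend : ∀ m b → Large m b → Σ[ b′ ∈ ω^ω ] b ≈[ m ] b′ × Large (suc m) b′
  large-extend m b large with em {Σ[ b′ ∈ ω^ω ] b ≈[ m ] b′ × Large (suc m) b′}
  ... | yes found = found
  ... | no  none  = ⊥-elim contradiction
    where
    counterexample : ∀ v → Σ[ b′ ∈ ω^ω ] b [ m ↦ v ] ≈[ suc m ] b′ × k b′ (K 0) < K (suc m)
    counterexample v with em {Σ[ b′ ∈ ω^ω ] b [ m ↦ v ] ≈[ suc m ] b′ × k b′ (K 0) < K (suc m)}
    ... | yes found = found
    ... | no  none′ = ⊥-elim (none (b [ m ↦ v ] , ↦-≈ v ≤-refl , λ b′ e → ≮⇒≥ λ lt → none′ (b′ , e , lt)))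

    b′ : ℕ → ω^ω
    b′ v = proj₁ (counterexample v)

    b≈b′ : ∀ v → b ≈[ m ] b′ v
    b≈b′ v = ≈-trans (↦-≈ v ≤-refl) (≈-mono (n≤1+n m) (proj₁ (proj₂ (counterexample v))))

    b′-at-m : ∀ v → b′ v m ≡ v
    b′-at-m v = trans (sym (at (proj₁ (proj₂ (counterexample v))) m ≤-refl)) (↦-here b m v)

    hole : ∀ v → Fin (K (suc m))
    hole v = fromℕ< (proj₂ (proj₂ (counterexample v)))

    contradiction : ⊥
    -- The values up to `K (suc m)` are one more than the available rows.
    contradiction with Fin.pigeonhole (n<1+n (K (suc m))) (hole ∘ toℕ)
    ... | i , j , i<j , eq = proj₂ (robust-bounded m) _ (large (b′ (toℕ i)) (b≈b′ (toℕ i)))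
      (robust-of-two (b′ (toℕ i)) (b′ (toℕ j)) m (K 0) (Fin.fromℕ<-injective _ _ _ _ eq)
        λ eq′ → <⇒≢ i<j (trans (sym (b′-at-m (toℕ i))) (trans eq′ (b′-at-m (toℕ j)))))

  approximation : ∀ m → Σ[ b ∈ ω^ω ] Large m b
  -- The row requested at index `K 0` is at least `K 0`, whatever the choices; this is why that
  -- index is used.
  approximation zero    = 𝟘 , λ b _ → n≤k b (K 0)
  approximation (suc m) =
    let b , large = approximation m
        b′ , _ , large′ = large-extend m b large
    in b′ , large′

  approximation-step : ∀ m → proj₁ (approximation m) ≈[ m ] proj₁ (approximation (suc m))
  approximation-step m =
    proj₁ (proj₂ (large-extend m (proj₁ (approximation m)) (proj₂ (approximation m))))

  -- The value at `a` is final from stage `suc a` on.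
  limit : ω^ω
  limit a = proj₁ (approximation (suc a)) a

  approximation≈limit : ∀ m → proj₁ (approximation m) ≈[ m ] limit
  approximation≈limit zero    = agree λ _ ()
  approximation≈limit (suc m) = agree λ i i<1+m → case i (m<1+n⇒m<n∨m≡n i<1+m)
    where
    case : ∀ i → i < m ⊎ i ≡ m → proj₁ (approximation (suc m)) i ≡ limit i
    case i (inj₂ refl) = refl
    case i (inj₁ i<m)  = trans (sym (at (approximation-step m) i i<m)) (at (approximation≈limit m) i i<m)

  -- The row obtained from `limit` is at least `K a` for every `a`, yet it is robust for an `a` that
  -- `r₋` has not read.
  irreducible : ⊥
  irreducible =
    let a , robust = robust-of-unread limit (K 0)
    in proj₂ (robust-bounded a) _ (proj₂ (approximation a) limit (approximation≈limit a)) robust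

theorem4p15 : ExcludedMiddle 0ℓ → ¬ (⟨ `∀ ∷ `∃ ∷ `∀ ∷ [] ⟩ ≤ₘ ⟨ `∃^∞ ∷ `∀^∞ ∷ `∀ ∷ [] ⟩)
theorem4p15 = irreducible
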